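{- Let $G$ be a loop-less digraph on $n$ vertices in which every vertex has in-degree at least $1$, and let $\mathring{G}$ be the digraph obtained from $G$ by adding a loop on every vertex. Then $\mathring{G}$ admits a boolean nilpotent function of class at most $4$. Moreover, if $G$ is symmetric or has a vertex of out-degree $n-1$, then $\mathring{G}$ admits a boolean nilpotent function of class at most $3$.
   Context: A digraph is symmetric if for every arc $(u,v)$, $(v,u)$ is also an arc. A boolean function on $[n]$ is a map $f:\{0,1\}^n\to\{0,1\}^n$; its (unsigned) interaction graph has an arc $(j,i)$ iff $f_i$ depends essentially on $x_j$, i.e. $f_i(a)\neq f_i(b)$ for some $a,b$ differing only in coordinate $j$ (loops included). A digraph $H$ on $[n]$ admits $f$ if the interaction graph of $f$ equals $H$. $f$ is nilpotent if $f^k$ is constant for some $k\geq 0$ ($f^0=\mathrm{id}$); the least such $k$ is its class. -}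

module Defs where

open import Data.Bool.Base using (Bool; T; _∨_)
open import Data.Fin.Base using (Fin)
open import Data.Fin.Properties using (_≟_)
open import Data.Fin.Subset using (Subset; ∣_∣)
open import Data.Nat.Base using (ℕ; _≤_)
open import Data.Product.Base using (_×_; ∃-syntax)
open import Data.Vec.Base using (Vec; lookup; tabulate)
open import Function.Bundles using (_⇔_)
import Function.Endo.Propositional as Endo
open import Relation.Binary.PropositionalEquality.Core using (_≡_; _≢_)
open import Relation.Nullary.Decidable.Core using (does)
open import Relation.Nullary.Negation.Core using (¬_)

-- Adjacency matrix: G u v is true iff (u , v) is an arc; loops are allowed.
Digraph : ℕ → Set
Digraph n = Fin n → Fin n → Bool

Arc : ∀ {n} → Digraph n → Fin n → Fin n → Set
Arc G u v = T (G u v)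

Loopless : ∀ {n} → Digraph n → Set
Loopless G = ∀ v → ¬ Arc G v v

outNeighbours : ∀ {n} → Digraph n → Fin n → Subset n
outNeighbours G u = tabulate (λ v → G u v)

inNeighbours : ∀ {n} → Digraph n → Fin n → Subset n
inNeighbours G v = tabulate (λ u → G u v)

outDegree : ∀ {n} → Digraph n → Fin n → ℕ
outDegree G u = ∣ outNeighbours G u ∣

inDegree : ∀ {n} → Digraph n → Fin n → ℕ
inDegree G v = ∣ inNeighbours G v ∣

addLoops : ∀ {n} → Digraph n → Digraph n
addLoops G u v = G u v ∨ does (u ≟ v)

Config : ℕ → Set
Config n = Vec Bool n

BooleanFunction : ℕ → Set
BooleanFunction n = Config n → Config n

DifferOnlyAt : ∀ {n} → Fin n → Config n → Config n → Set
DifferOnlyAt j a b =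
  lookup a j ≢ lookup b j × (∀ k → k ≢ j → lookup a k ≡ lookup b k)

-- (j , i) is an arc of the interaction graph of f: component i of f
-- depends essentially on coordinate j of its argument.
InteractionArc : ∀ {n} → BooleanFunction n → Fin n → Fin n → Set
InteractionArc f j i =
  ∃[ a ] ∃[ b ] DifferOnlyAt j a b × lookup (f a) i ≢ lookup (f b) i

Admits : ∀ {n} → Digraph n → BooleanFunction n → Set
Admits H f = ∀ j i → Arc H j i ⇔ InteractionArc f j i

infixr 8 _^_

_^_ : ∀ {n} → BooleanFunction n → ℕ → BooleanFunction n
_^_ {n} = Endo._^_ (Config n)

Constant : ∀ {n} → BooleanFunction n → Set
Constant f = ∃[ c ] (∀ x → f x ≡ c)

Nilpotent : ∀ {n} → BooleanFunction n → Set
Nilpotent f = ∃[ k ] Constant (f ^ k)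

HasClass : ∀ {n} → BooleanFunction n → ℕ → Set
HasClass f k = Constant (f ^ k) × (∀ m → Constant (f ^ m) → k ≤ m)

AdmitsNilpotentOfClassAtMost : ∀ {n} → Digraph n → ℕ → Set
AdmitsNilpotentOfClassAtMost H c =
  ∃[ f ] Admits H f × Nilpotent f × (∃[ k ] HasClass f k × k ≤ c)

{-# OPTIONS --safe #-}
module Submission where

-- Let component v of f be the conjunction of the literals x_u over its
-- in-neighbours u and of a loop literal: ¬ x_v for v in a chosen set Q, and x_v
-- for v outside Q.  If v ∉ Q has an in-neighbour u ∈ Q, then f²_v = 0: it would
-- need f_u = f_v = 1, hence x_u = 0 and x_u = 1 simultaneously.  A component that
-- is identically 0 at time k forces 0 at time k + 1 along every positive arc.
-- Taking for Q a quasi-kernel (an independent set from which every vertex is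
-- within distance 2) gives class at most 4.  When Q is a kernel, or the singleton
-- of a vertex dominating all others, every vertex outside Q has an in-neighbour
-- in Q and the class is at most 3.

open import Defs
open import Data.Bool.Base using (Bool; true; false; not)
open import Data.Bool.Properties using (T?; T-≡; T-∨; ¬-not; not-¬) renaming (_≟_ to _≟ᵇ_)
open import Data.Fin.Base using (Fin; _<_; _>_)
open import Data.Fin.Induction using (<-wellFounded; >-wellFounded)
open import Data.Fin.Properties using (_≟_; _<?_; <-cmp; any?; all?)
open import Data.Fin.Subset using (∣_∣; _∈_; ⊤; _-_)
open import Data.Fin.Subset.Properties using (nonempty?; Empty-unique; ∣⊥∣≡0; ∣⊤∣≡n; ∈⊤; p⊆q⇒∣p∣≤∣q∣; x∈p⇒∣p-x∣<∣p∣; x∈p∧x≢y⇒x∈p-y; anySubset?)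
open import Data.Nat.Base using (ℕ; zero; suc; _≤_; _∸_; z≤n; s≤s)
open import Data.Nat.Properties using (≤-trans; 1+n≰n; <⇒≤pred)
open import Data.Product.Base using (_×_; _,_; proj₁; proj₂; ∃-syntax)
open import Data.Sum.Base using (_⊎_; inj₁; inj₂)
open import Data.Vec.Base using (lookup; tabulate; replicate; updateAt)
open import Data.Vec.Properties using (lookup∘tabulate; lookup∘updateAt; lookup∘updateAt′; lookup-replicate; []=⇒lookup; ≡-dec)
open import Data.Vec.Relation.Binary.Pointwise.Extensional using (ext; Pointwise-≡⇒≡)
open import Function.Base using (_∘_)
open import Function.Bundles using (mk⇔; Equivalence)
open import Induction.WellFounded using (WellFounded; Acc; acc; module Subrelation)
open import Level using (0ℓ)
open import Relation.Binary.Core using (Rel)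
open import Relation.Binary.Definitions using (Symmetric; tri<; tri≈; tri>) renaming (Decidable to Decidable₂)
open import Relation.Binary.PropositionalEquality.Core using (_≡_; _≢_; refl; sym; trans; cong; subst)
open import Relation.Nullary.Decidable using (Dec; yes; no; does; _×-dec_; _→-dec_; ¬?; map′; dec-true; dec-false; decidable-stable)
open import Relation.Nullary.Negation using (¬_; contradiction)
open import Relation.Unary using (Pred; Decidable)

private
  variable
    n : ℕ

does-true⇒ : ∀ {A : Set} (a? : Dec A) → does a? ≡ true → A
does-true⇒ (yes a) _ = a

-- Kernels of well-founded relations.

-- Mutual data types avoid the negative occurrence in the defining property
-- "v is in the kernel iff no predecessor of v is".
module _ {A : Set} (R : Rel A 0ℓ) where

  data Kernel   : Pred A 0ℓ
  data Absorbed : Pred A 0ℓ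

  data Kernel where
    kernel : ∀ {v} → (∀ {u} → R u v → Absorbed u) → Kernel v

  data Absorbed where
    absorbed : ∀ {u v} → R u v → Kernel u → Absorbed v

  -- A kernel predecessor of `v` witnessing `Absorbed v` is itself absorbed, since `v` lies in the
  -- kernel; the same conflict recurs on smaller derivations.
  Kernel⇒¬Absorbed : ∀ {v} → Kernel v → ¬ Absorbed v
  Kernel⇒¬Absorbed (kernel abs) (absorbed r k) = Kernel⇒¬Absorbed k (abs r)

  kernel-independent : ∀ {u v} → R u v → Kernel u → ¬ Kernel v
  kernel-independent r ku kv = Kernel⇒¬Absorbed kv (absorbed r ku)

module _ {R : Rel (Fin n) 0ℓ} (R? : Decidable₂ R) (wf : WellFounded R) where

  -- Well-founded recursion: once all predecessors are classified, either one lies in the kernel and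
  -- absorbs `v`, or all are absorbed and `v` joins the kernel.
  kernel⊎absorbed : ∀ v → Kernel R v ⊎ Absorbed R v
  kernel⊎absorbed v = go v (wf v)
    where
    go : ∀ v → Acc R v → Kernel R v ⊎ Absorbed R v
    go v (acc rs) with any? kernelPredecessor?
      where
      kernelPredecessor? : Decidable (λ u → R u v × Kernel R u)
      kernelPredecessor? u with R? u v
      ... | no ¬r = no (¬r ∘ proj₁)
      ... | yes r with go u (rs r)
      ...   | inj₁ k = yes (r , k)
      ...   | inj₂ a = no λ (_ , k) → Kernel⇒¬Absorbed R k a
    ... | yes (_ , r , k) = inj₂ (absorbed r k)
    ... | no none         = inj₁ (kernel abs)
      where
      abs : ∀ {u} → R u v → Absorbed R u
      abs {u} r with go u (rs r)
      ... | inj₁ k = contradiction (u , r , k) none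
      ... | inj₂ a = a

  kernel? : Decidable (Kernel R)
  kernel? v with kernel⊎absorbed v
  ... | inj₁ k = yes k
  ... | inj₂ a = no λ k → Kernel⇒¬Absorbed R k a

  kernel-absorbing : ∀ {v} → ¬ Kernel R v → ∃[ u ] R u v × Kernel R u
  kernel-absorbing {v} ¬k with kernel⊎absorbed v
  ... | inj₁ k              = contradiction k ¬k
  ... | inj₂ (absorbed r k) = _ , r , k

-- Degree conditions turned into arcs.

module _ (G : Digraph n) where

  inNeighbour : ∀ {v} → 1 ≤ inDegree G v → ∃[ u ] Arc G u v
  inNeighbour {v} 1≤d with nonempty? (inNeighbours G v)
  ... | yes (u , u∈N) = u , Equivalence.from T-≡ (trans (sym (lookup∘tabulate _ u)) ([]=⇒lookup u∈N))
  ... | no empty = contradiction (subst (1 ≤_) (trans (cong ∣_∣ (Empty-unique empty)) (∣⊥∣≡0 n)) 1≤d) λ ()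

  -- Counting: the out-neighbourhood misses `u`, and if it also missed `v` it would have at most n -
  -- 2 elements.
  dominating : Loopless G → ∀ {u} → outDegree G u ≡ n ∸ 1 → ∀ {v} → v ≢ u → Arc G u v
  dominating loopless {u} d≡n-1 {v} v≢u = decidable-stable (T? _) λ ¬uv →
    let
      N = outNeighbours G u

      arc : ∀ {w} → w ∈ N → Arc G u w
      arc {w} w∈N = Equivalence.from T-≡ (trans (sym (lookup∘tabulate _ w)) ([]=⇒lookup w∈N))

      N⊆⊤-u-v : ∀ {w} → w ∈ N → w ∈ (⊤ - u) - v
      N⊆⊤-u-v w∈N = x∈p∧x≢y⇒x∈p-y (x∈p∧x≢y⇒x∈p-y ∈⊤ λ { refl → loopless _ (arc w∈N) }) λ { refl → ¬uv (arc w∈N) }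

      ∣N∣<∣⊤-u∣ : suc ∣ N ∣ ≤ ∣ ⊤ - u ∣
      ∣N∣<∣⊤-u∣ = ≤-trans (s≤s (p⊆q⇒∣p∣≤∣q∣ N⊆⊤-u-v)) (x∈p⇒∣p-x∣<∣p∣ {x = v} {p = ⊤ - u} (x∈p∧x≢y⇒x∈p-y ∈⊤ v≢u))

      ∣⊤-u∣≤n-1 : ∣ ⊤ - u ∣ ≤ n ∸ 1
      ∣⊤-u∣≤n-1 = <⇒≤pred (subst (suc ∣ ⊤ - u ∣ ≤_) (∣⊤∣≡n n) (x∈p⇒∣p-x∣<∣p∣ {x = u} {p = ⊤} ∈⊤))
    in 1+n≰n (subst (λ d → suc d ≤ n ∸ 1) d≡n-1 (≤-trans ∣N∣<∣⊤-u∣ ∣⊤-u∣≤n-1))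

arc⇒addLoops : ∀ (G : Digraph n) u v → Arc G u v → Arc (addLoops G) u v
arc⇒addLoops G u v uv = Equivalence.from (T-∨ {G u v}) (inj₁ uv)

addLoops-loop : ∀ (G : Digraph n) v → Arc (addLoops G) v v
addLoops-loop G v = Equivalence.from (T-∨ {G v v}) (inj₂ (Equivalence.from T-≡ (dec-true (v ≟ v) refl)))

-- Existence of the exact class.

constant? : (f : BooleanFunction n) → Dec (Constant f)
constant? {n} f with anySubset? (λ x → ¬? (≡-dec _≟ᵇ_ (f x) (f o)))
  where o = replicate n false
-- A configuration is also a `Subset n`, so the search runs over all inputs; `o` is an arbitrary
-- reference point.
... | yes (x , fx≢fo) = no λ (_ , const) → fx≢fo (trans (const x) (sym (const _)))
... | no none         = yes (_ , λ x → decidable-stable (≡-dec _≟ᵇ_ _ _) λ fx≢fo → none (x , fx≢fo))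

least : ∀ {P : Pred ℕ 0ℓ} → Decidable P → ∀ {k} → P k → ∃[ m ] (P m × (∀ l → P l → m ≤ l)) × m ≤ k
least P? {zero} p = 0 , (p , λ _ _ → z≤n) , z≤n
least P? {suc k} p with P? 0
... | yes p₀ = 0 , (p₀ , λ _ _ → z≤n) , z≤n
... | no ¬p₀ with m , (pm , minimal) , m≤k ← least (P? ∘ suc) p =
  suc m , (pm , λ { zero p₀ → contradiction p₀ ¬p₀ ; (suc l) pl → s≤s (minimal l pl) }) , s≤s m≤k

-- Conjunctions of signed literals.

module Conjunctive (H : Digraph n) (sign : Fin n → Fin n → Bool) where

  -- `sign u v` is the value of the `u`-coordinate that satisfies its literal in component `v`.
  record Matches (x : Config n) (v : Fin n) : Set where
    constructor matches
    field match : ∀ u → Arc H u v → lookup x u ≡ sign u v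

  open Matches public

  matches? : ∀ x → Decidable (Matches x)
  matches? x v = map′ matches match (all? λ u → T? (H u v) →-dec (lookup x u ≟ᵇ sign u v))

  conjunction : BooleanFunction n
  conjunction x = tabulate (does ∘ matches? x)

  matches⇒true : ∀ x v → Matches x v → lookup (conjunction x) v ≡ true
  matches⇒true x v m = trans (lookup∘tabulate _ v) (dec-true (matches? x v) m)

  true⇒matches : ∀ x v → lookup (conjunction x) v ≡ true → Matches x v
  true⇒matches x v eq = does-true⇒ (matches? x v) (trans (sym (lookup∘tabulate _ v)) eq)

  -- Flipping coordinate `j` of an input that satisfies all literals of component `i` falsifies
  -- exactly the literal on `j`, so every arc is essential.
  conjunction-admits : Admits H conjunction
  conjunction-admits j i = mk⇔ arc⇒interaction interaction⇒arc
    where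
    arc⇒interaction : Arc H j i → InteractionArc conjunction j i
    arc⇒interaction ji = a , b , (aⱼ≢bⱼ , λ k k≢j → sym (lookup∘updateAt′ k j k≢j a)) , different
      where
      a = tabulate (λ u → sign u i)
      b = updateAt a j not

      aⱼ≢bⱼ : lookup a j ≢ lookup b j
      aⱼ≢bⱼ eq = not-¬ refl (trans eq (lookup∘updateAt j a))

      a-matches : Matches a i
      a-matches = matches λ u _ → lookup∘tabulate _ u

      different : lookup (conjunction a) i ≢ lookup (conjunction b) i
      different eq = aⱼ≢bⱼ (trans (match a-matches j ji) (sym (match b-matches j ji)))
        where
        b-matches : Matches b i
        b-matches = true⇒matches b i (trans (sym eq) (matches⇒true a i a-matches))

    matches-transfer : ¬ Arc H j i → ∀ {a b} → (∀ k → k ≢ j → lookup a k ≡ lookup b k) →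
                       Matches a i → Matches b i
    matches-transfer ¬ji a≈b m = matches λ u ui →
      trans (sym (a≈b u λ { refl → ¬ji ui })) (match m u ui)

    interaction⇒arc : InteractionArc conjunction j i → Arc H j i
    interaction⇒arc (a , b , (_ , a≈b) , different) = decidable-stable (T? _) λ ¬ji →
      different (same ¬ji (matches? a i))
      where
      same : ¬ Arc H j i → Dec (Matches a i) → lookup (conjunction a) i ≡ lookup (conjunction b) i
      same ¬ji (yes m) = trans (matches⇒true a i m) (sym (matches⇒true b i (matches-transfer ¬ji a≈b m)))
      same ¬ji (no ¬m) = trans (¬-not (¬m ∘ true⇒matches a i))
        (sym (¬-not (¬m ∘ matches-transfer ¬ji (λ k k≢j → sym (a≈b k k≢j)) ∘ true⇒matches b i)))

  record Vanishes (k : ℕ) (v : Fin n) : Set where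
    constructor vanishes
    field ≢true : ∀ x → lookup ((conjunction ^ k) x) v ≢ true

  open Vanishes public

  vanishes-step : ∀ {k u v} → Arc H u v → sign u v ≡ true → Vanishes k u → Vanishes (suc k) v
  vanishes-step {k} {u} {v} uv positive u-vanishes = vanishes λ x eq →
    ≢true u-vanishes x (trans (match (true⇒matches ((conjunction ^ k) x) v eq) u uv) positive)

  vanishes⇒nilpotent : ∀ k → (∀ v → Vanishes k v) → AdmitsNilpotentOfClassAtMost H k
  vanishes⇒nilpotent k all-vanish =
    conjunction , conjunction-admits , (k , constant) , least (λ m → constant? (conjunction ^ m)) constant
    where
    constant : Constant (conjunction ^ k)
    constant = replicate n false , λ x → Pointwise-≡⇒≡ (ext λ v →
      trans (¬-not (≢true (all-vanish v) x)) (sym (lookup-replicate v false)))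

-- Negative loops on a chosen set `Q`.

module Construction (G : Digraph n) {Q : Pred (Fin n) 0ℓ} (Q? : Decidable Q) where

  sign : Fin n → Fin n → Bool
  sign u v = not (does ((u ≟ v) ×-dec Q? v))

  open Conjunctive (addLoops G) sign public

  sign-positive : ∀ u v → ¬ (u ≡ v × Q v) → sign u v ≡ true
  sign-positive u v ¬p = cong not (dec-false ((u ≟ v) ×-dec Q? v) ¬p)

  sign-loop : ∀ v → Q v → sign v v ≡ false
  sign-loop v q = cong not (dec-true ((v ≟ v) ×-dec Q? v) (refl , q))

  vanishes₂ : ∀ {u v} → Arc G u v → Q u → ¬ Q v → Vanishes 2 v
  vanishes₂ {u} {v} uv qu ¬qv = vanishes λ x eq →
    let
      -- A 1 at `v` after two steps requires a 1 after one step both at `v`, by its positive loop,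
      -- and at `u`.
      fx-matches : Matches (conjunction x) v
      fx-matches = true⇒matches (conjunction x) v eq

      positive : ∀ w → sign w v ≡ true
      positive w = sign-positive w v (¬qv ∘ proj₂)

      v-matches : Matches x v
      v-matches = true⇒matches x v (trans (match fx-matches v (addLoops-loop G v)) (positive v))

      u-matches : Matches x u
      u-matches = true⇒matches x u (trans (match fx-matches u (arc⇒addLoops G u v uv)) (positive u))

      xᵤ≡1 : lookup x u ≡ true
      xᵤ≡1 = trans (match v-matches u (arc⇒addLoops G u v uv)) (positive u)

      xᵤ≡0 : lookup x u ≡ false
      xᵤ≡0 = trans (match u-matches u (addLoops-loop G u)) (sign-loop u qu)
    in contradiction (trans (sym xᵤ≡1) xᵤ≡0) λ ()

  vanishes-outside : ∀ {k u v} → Arc G u v → ¬ Q v → Vanishes k u → Vanishes (suc k) v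
  vanishes-outside {u = u} {v} uv ¬qv = vanishes-step (arc⇒addLoops G u v uv) (sign-positive u v (¬qv ∘ proj₂))

  vanishes-persists : ∀ {k v} → ¬ Q v → Vanishes k v → Vanishes (suc k) v
  vanishes-persists {v = v} ¬qv = vanishes-step (addLoops-loop G v) (sign-positive v v (¬qv ∘ proj₂))

  -- Off `Q`, positive loops preserve the zeros; each vertex of `Q` receives a zero one step later
  -- from an in-neighbour outside `Q`.
  nilpotent : ∀ k → (∀ v → Q v → ∃[ u ] Arc G u v × ¬ Q u) → (∀ v → ¬ Q v → Vanishes k v) →
              AdmitsNilpotentOfClassAtMost (addLoops G) (suc k)
  nilpotent k outer vanishes-off-Q = vanishes⇒nilpotent (suc k) λ v → everywhere v (Q? v)
    where
    everywhere : ∀ v → Dec (Q v) → Vanishes (suc k) v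
    everywhere v (no ¬qv) = vanishes-persists ¬qv (vanishes-off-Q v ¬qv)
    everywhere v (yes qv) with u , uv , ¬qu ← outer v qv =
      vanishes-step (arc⇒addLoops G u v uv) (sign-positive u v λ { (refl , _) → ¬qu qv }) (vanishes-off-Q u ¬qu)

-- Quasi-kernels.

-- The forward arcs are acyclic and so have a kernel K; only backward arcs remain
-- inside K, so they have a kernel there, and it is a quasi-kernel of G.
module QuasiKernel (G : Digraph n) (loopless : Loopless G) where

  Forward : Rel (Fin n) 0ℓ
  Forward u v = Arc G u v × u < v

  forward? : Decidable₂ Forward
  forward? u v = T? (G u v) ×-dec (u <? v)

  forward-wf : WellFounded Forward
  forward-wf = Subrelation.wellFounded proj₂ <-wellFounded

  K : Pred (Fin n) 0ℓ
  K = Kernel Forward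

  K? : Decidable K
  K? = kernel? forward? forward-wf

  K-absorbing : ∀ {v} → ¬ K v → ∃[ u ] Forward u v × K u
  K-absorbing = kernel-absorbing forward? forward-wf

  -- Only tails are restricted to `K`: membership of a vertex of `K` in the kernel then depends on
  -- its predecessors in `K` alone, as in the subgraph induced by `K`.
  Backward : Rel (Fin n) 0ℓ
  Backward u v = (Arc G u v × K u) × u > v

  backward? : Decidable₂ Backward
  backward? u v = (T? (G u v) ×-dec K? u) ×-dec (v <? u)

  backward-wf : WellFounded Backward
  backward-wf = Subrelation.wellFounded proj₂ >-wellFounded

  Q : Pred (Fin n) 0ℓ
  Q v = K v × Kernel Backward v

  Q? : Decidable Q
  Q? v = K? v ×-dec kernel? backward? backward-wf v

  -- A forward arc inside `Q` contradicts the first kernel, a backward arc the second.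
  Q-independent : ∀ {u v} → Arc G u v → Q v → ¬ Q u
  Q-independent {u} {v} uv (kv , k′v) (ku , k′u) with <-cmp u v
  ... | tri< u<v _ _ = kernel-independent Forward (uv , u<v) ku kv
  ... | tri≈ _ refl _ = loopless u uv
  ... | tri> _ _ v<u = kernel-independent Backward ((uv , ku) , v<u) k′u k′v

  Q-absorbs-K : ∀ {v} → K v → ¬ Q v → ∃[ u ] Arc G u v × Q u
  Q-absorbs-K kv ¬qv with u , ((uv , ku) , _) , k′u ← kernel-absorbing backward? backward-wf (λ k′v → ¬qv (kv , k′v)) =
    u , uv , ku , k′u

  -- By symmetry a backward arc inside `K` yields a forward one, so `K` is already a kernel of `G`.
  K-independent : Symmetric (Arc G) → ∀ {u v} → Arc G u v → K v → ¬ K u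
  K-independent symmetric {u} {v} uv kv ku with <-cmp u v
  ... | tri< u<v _ _ = kernel-independent Forward (uv , u<v) ku kv
  ... | tri≈ _ refl _ = loopless u uv
  ... | tri> _ _ v<u = kernel-independent Forward (symmetric uv , v<u) kv ku

-- The three choices of `Q`.

module _ (G : Digraph n) (loopless : Loopless G) (1≤inDegree : ∀ v → 1 ≤ inDegree G v) where

  open QuasiKernel G loopless

  nilpotent-class≤4 : AdmitsNilpotentOfClassAtMost (addLoops G) 4
  nilpotent-class≤4 = nilpotent 3 outer vanishes₃
    where
    open Construction G Q?

    outer : ∀ v → Q v → ∃[ u ] Arc G u v × ¬ Q u
    outer v qv with u , uv ← inNeighbour G (1≤inDegree v) = u , uv , Q-independent uv qv

    vanishes₃ : ∀ v → ¬ Q v → Vanishes 3 v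
    vanishes₃ v ¬qv with K? v
    ... | yes kv with u , uv , qu ← Q-absorbs-K kv ¬qv = vanishes-persists ¬qv (vanishes₂ {u} uv qu ¬qv)
    ... | no ¬kv with u , (uv , _) , ku ← K-absorbing ¬kv with Q? u
    ...   | yes qu = vanishes-persists ¬qv (vanishes₂ {u} uv qu ¬qv)
    -- Distance two from `Q`: `u` vanishes at time 2 and passes its zero to `v` at time 3.
    ...   | no ¬qu with w , wu , qw ← Q-absorbs-K ku ¬qu = vanishes-outside {u = u} uv ¬qv (vanishes₂ {w} wu qw ¬qu)

  nilpotent-class≤3-symmetric : Symmetric (Arc G) → AdmitsNilpotentOfClassAtMost (addLoops G) 3
  nilpotent-class≤3-symmetric symmetric = nilpotent 2 outer vanishes-off-K
    where
    open Construction G K?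

    outer : ∀ v → K v → ∃[ u ] Arc G u v × ¬ K u
    outer v kv with u , uv ← inNeighbour G (1≤inDegree v) = u , uv , K-independent symmetric uv kv

    vanishes-off-K : ∀ v → ¬ K v → Vanishes 2 v
    vanishes-off-K v ¬kv with u , (uv , _) , ku ← K-absorbing ¬kv = vanishes₂ {u} uv ku ¬kv

  nilpotent-class≤3-dominating : ∀ {r} → (∀ {v} → v ≢ r → Arc G r v) →
                                 AdmitsNilpotentOfClassAtMost (addLoops G) 3
  nilpotent-class≤3-dominating {r} dom = nilpotent 2 outer λ v v≢r → vanishes₂ {v = v} (dom v≢r) refl v≢r
    where
    -- Here `Q` is the singleton of `r`, whose in-neighbours differ from `r` because `G` has no
    -- loops.
    open Construction G (_≟ r)

    outer : ∀ v → v ≡ r → ∃[ u ] Arc G u v × u ≢ r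
    outer v refl with u , uv ← inNeighbour G (1≤inDegree v) = u , uv , λ { refl → loopless u uv }

theorem6 : ∀ (n : ℕ) (G : Digraph n) →
    Loopless G →
    (∀ v → 1 ≤ inDegree G v) →
    AdmitsNilpotentOfClassAtMost (addLoops G) 4
    × (Symmetric (Arc G) ⊎ (∃[ u ] outDegree G u ≡ n ∸ 1) →
    AdmitsNilpotentOfClassAtMost (addLoops G) 3)
theorem6 n G loopless 1≤d = nilpotent-class≤4 G loopless 1≤d , λ
  { (inj₁ symmetric)   → nilpotent-class≤3-symmetric G loopless 1≤d symmetric
  ; (inj₂ (_ , d≡n-1)) → nilpotent-class≤3-dominating G loopless 1≤d (dominating G loopless d≡n-1)
  }
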